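{- For every $m\ge1$ and every assignment $A\in\{0,1\}^{(m+1)\times m}$ to the variables $x_{i,j}$ ($i\in[m+1]$, $j\in[m]$), $\mathrm{viol}_{\mathrm{PHP}^\delta}(A)=\mathrm{viol}_{\mathrm{PHP}_m}(A)-1$.
   Context: For a set $F$ of clauses and a total assignment $A$, $\mathrm{viol}_F(A)$ is the number of clauses of $F$ falsified by $A$. $\mathrm{PHP}_m$ consists of the pigeon axioms $\bigvee_{j=1}^m x_{i,j}$ for each $i\in[m+1]$, and the hole axioms $\neg x_{i,j}\vee\neg x_{i',j}$ for each $j\in[m]$ and $1\le i<i'\le m+1$. $\mathrm{PHP}^\delta=\bigcup_{i\in[m+1]}P_i^\delta\cup\bigcup_{j\in[m]}(H1_j^\delta\cup H2_j^\delta)$, where $$P_i^\delta=\Bigl\{\neg x_{i,j}\vee\bigl(\textstyle\bigvee_{j<\ell<k}x_{i,\ell}\bigr)\vee\neg x_{i,k}\;\Big|\;1\le j<k\le m\Bigr\},$$ $$H1_j^\delta=\Bigl\{\textstyle\bigvee_{i=1}^{m+1}x_{i,j}\Bigr\},$$ $$H2_j^\delta=\Bigl\{\neg x_{i,j}\vee\bigl(\textstyle\bigvee_{i<\ell<k}x_{\ell,j}\bigr)\vee\neg x_{k,j}\vee\neg x_{i',j}\;\Big|\;1\le i<k<i'\le m+1\Bigr\}.$$ -}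

module Defs where

open import Data.Bool.Base using (Bool; true; false; not)
import Data.Bool.Properties as Bool
open import Data.Bool.ListAction using (any)
open import Data.Fin.Base using (Fin)
import Data.Fin.Properties as Fin
open import Data.List.Base
  using (List; []; _∷_; [_]; _++_; map; concatMap; filter; length; deduplicate; allFin; cartesianProduct)
import Data.List.Relation.Binary.Subset.DecPropositional as DecSubset
open import Data.List.Relation.Binary.Subset.Propositional using (_⊆_)
open import Data.Nat.Base using (ℕ; suc)
open import Data.Product.Base using (_×_; _,_)
import Data.Product.Properties as Product
open import Relation.Binary.Definitions using (Decidable; DecidableEquality)
open import Relation.Binary.PropositionalEquality using (_≡_; refl; cong)
open import Relation.Nullary.Decidable using (no; map′; _×-dec_)

data Literal (V : Set) : Set where
  pos neg : V → Literal V

Clause : Set → Set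
Clause V = List (Literal V)

-- A finite set of clauses, given by an enumeration; order and repetitions
-- are irrelevant, see viol.
Formula : Set → Set
Formula V = List (Clause V)

Assignment : Set → Set
Assignment V = V → Bool

evalLiteral : {V : Set} → Assignment V → Literal V → Bool
evalLiteral A (pos x) = A x
evalLiteral A (neg x) = not (A x)

evalClause : {V : Set} → Assignment V → Clause V → Bool
evalClause A = any (evalLiteral A)

-- Equality of clauses as sets of literals.
infix 4 _≋_
_≋_ : {V : Set} → Clause V → Clause V → Set
C ≋ D = C ⊆ D × D ⊆ C

module _ {V : Set} (_≟_ : DecidableEquality V) where

  literal-≟ : DecidableEquality (Literal V)
  literal-≟ (pos x) (pos y) = map′ (cong pos) (λ { refl → refl }) (x ≟ y)
  literal-≟ (pos _) (neg _) = no λ ()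
  literal-≟ (neg _) (pos _) = no λ ()
  literal-≟ (neg x) (neg y) = map′ (cong neg) (λ { refl → refl }) (x ≟ y)

  clause-≋? : Decidable (_≋_ {V})
  clause-≋? C D = (C ⊆? D) ×-dec (D ⊆? C)
    where open DecSubset literal-≟ using (_⊆?_)

  -- A formula is a set, so clauses with the same literals count only once.
  viol : Formula V → Assignment V → ℕ
  viol F A =
    length (filter (λ C → evalClause A C Bool.≟ false) (deduplicate clause-≋? F))

-- (i , j) is the variable x_{i,j}: pigeon i sits in hole j.
Var : ℕ → Set
Var m = Fin (suc m) × Fin m

var-≟ : (m : ℕ) → DecidableEquality (Var m)
var-≟ m = Product.≡-dec Fin._≟_ Fin._≟_

pairs : (n : ℕ) → List (Fin n × Fin n)
pairs n = filter (λ (a , b) → a Fin.<? b) (cartesianProduct (allFin n) (allFin n))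

triples : (n : ℕ) → List (Fin n × Fin n × Fin n)
triples n =
  filter (λ (a , b , c) → (a Fin.<? b) ×-dec (b Fin.<? c))
         (cartesianProduct (allFin n) (cartesianProduct (allFin n) (allFin n)))

between : {n : ℕ} → Fin n → Fin n → List (Fin n)
between {n} a b = filter (λ ℓ → (a Fin.<? ℓ) ×-dec (ℓ Fin.<? b)) (allFin n)

module _ (m : ℕ) where

  pigeonAxiom : Fin (suc m) → Clause (Var m)
  pigeonAxiom i = map (λ j → pos (i , j)) (allFin m)

  holeAxioms : Fin m → Formula (Var m)
  holeAxioms j = map (λ (i , i′) → neg (i , j) ∷ neg (i′ , j) ∷ []) (pairs (suc m))

  PHP : Formula (Var m)
  PHP = map pigeonAxiom (allFin (suc m)) ++ concatMap holeAxioms (allFin m)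

  Pᵟ : Fin (suc m) → Formula (Var m)
  Pᵟ i =
    map (λ (j , k) →
             neg (i , j) ∷ map (λ ℓ → pos (i , ℓ)) (between j k) ++ [ neg (i , k) ])
        (pairs m)

  H1ᵟ : Fin m → Formula (Var m)
  H1ᵟ j = [ map (λ i → pos (i , j)) (allFin (suc m)) ]

  H2ᵟ : Fin m → Formula (Var m)
  H2ᵟ j =
    map (λ (i , k , i′) →
             neg (i , j) ∷ map (λ ℓ → pos (ℓ , j)) (between i k)
               ++ neg (k , j) ∷ neg (i′ , j) ∷ [])
        (triples (suc m))

  PHPᵟ : Formula (Var m)
  PHPᵟ = concatMap Pᵟ (allFin (suc m)) ++ concatMap (λ j → H1ᵟ j ++ H2ᵟ j) (allFin m)

module Submission where

-- For a Boolean vector with r ones, exactly r − 1 + [r = 0] pairs of ones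
-- have only zeros between them. In row i this counts the violated clauses of
-- P_i, and [r = 0] is the violated pigeon axiom. In a column with c ones,
-- H2 is violated once for each such pair and each later one, that is,
-- (c − 1)(c − 2)/2 times for c ≥ 1, so H1 and H2 together are violated
-- C(c,2) − c + 1 times, also for c = 0. Summing over the m + 1 rows and the
-- m columns, the ones of A cancel and the constants differ by one. Since viol
-- counts clauses up to equality of literal sets, one also needs that the
-- clauses of each formula are pairwise distinct: the ordered list of negated
-- variables recovers the indices within a family.

open import Defs
open import Data.Bool.Base using (Bool; true; false; not; _∧_; _∨_; if_then_else_)
open import Data.Bool.ListAction using (any; or)
import Data.Bool.Properties as Bool
open import Data.Fin.Base using (Fin; zero; suc; _<_)
import Data.Fin.Properties as Fin
open import Data.List.Base
  using (List; []; _∷_; [_]; _++_; map; concatMap; filter; length; deduplicate;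
         allFin; tabulate; cartesianProduct)
open import Data.List.Properties using (filter-all; map-++; map-∘; map-tabulate)
open import Data.List.Membership.Propositional using (_∈_)
open import Data.List.Relation.Binary.Subset.Propositional using (_⊆_)
open import Data.List.Relation.Binary.Subset.Propositional.Properties using (concatMap⁺)
open import Data.List.Relation.Unary.All as All using (All; []; _∷_)
import Data.List.Relation.Unary.All.Properties as All
open import Data.List.Relation.Unary.AllPairs as AllPairs using (AllPairs; []; _∷_)
import Data.List.Relation.Unary.AllPairs.Properties as AllPairs
open import Data.List.Relation.Unary.Any using (Any; here; there)
open import Data.List.Relation.Unary.Unique.Propositional using (Unique)
import Data.List.Relation.Unary.Unique.Propositional.Properties as Unique
open import Data.Nat.Base using (ℕ; zero; suc; _+_; _≥_)
open import Data.Nat.ListAction using () renaming (sum to sumˡ)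
open import Data.Nat.ListAction.Properties using () renaming (sum-++ to sumˡ-++)
open import Data.Nat.Properties
  using (+-comm; +-assoc; +-identityʳ; +-cancelʳ-≡; +-*-semiring)
open import Data.Nat.Tactic.RingSolver using (solve-∀)
open import Data.Product.Base using (∃; _×_; _,_; proj₁; proj₂)
open import Function.Base using (_∘_; id)
open import Relation.Binary.Definitions using (DecidableEquality) renaming (Decidable to Decidable₂)
open import Relation.Binary.PropositionalEquality
  using (_≡_; refl; sym; trans; cong; cong₂; subst₂; module ≡-Reasoning)
open import Relation.Nullary using (¬_; contradiction)
open import Relation.Nullary.Decidable using (does; _×-dec_)
open import Relation.Unary using (Decidable)

open import Algebra.Properties.Semiring.Sum +-*-semiring
  using (sum-syntax; sum-cong-≗; ∑-distrib-+; ∑-comm)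
  renaming (sum-replicate-zero to ∑-zero)

open ≡-Reasoning

private variable
  X Y V : Set
  n : ℕ

-- Counting in Boolean vectors

⟦_⟧ : Bool → ℕ
⟦ false ⟧ = 0
⟦ true  ⟧ = 1

when : Bool → ℕ → ℕ
when b x = if b then x else 0

_<ᶠ_ : Fin n → Fin n → Bool
i <ᶠ j = does (i Fin.<? j)

ones : (Fin n → Bool) → ℕ
ones {n} a = ∑[ i < n ] ⟦ a i ⟧

some : (Fin n → Bool) → Bool
some a = or (tabulate a)

-- What `inside` reduces to on the tail of a vector when its left end is the front entry.
before : (Fin n → Bool) → Fin n → Bool
before a k = some (λ ℓ → (ℓ <ᶠ k) ∧ a ℓ)

inside : (Fin n → Bool) → Fin n → Fin n → Bool
inside a j k = some (λ ℓ → ((j <ᶠ ℓ) ∧ (ℓ <ᶠ k)) ∧ a ℓ)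

some-false : ∀ n → some {n} (λ _ → false) ≡ false
some-false zero    = refl
some-false (suc n) = some-false n

∑-one : ∀ n → ∑[ i < n ] 1 ≡ n
∑-one zero    = refl
∑-one (suc n) = cong suc (∑-one n)

∑-when : ∀ b (f : Fin n → ℕ) → ∑[ i < n ] when b (f i) ≡ when b (∑[ i < n ] f i)
∑-when     true  f = refl
∑-when {n} false f = ∑-zero n

∑-when-zero : ∀ n → ∑[ j < n ] ∑[ k < n ] when (j <ᶠ k) 0 ≡ 0
∑-when-zero n =
  trans (sum-cong-≗ {n} λ j → trans (sum-cong-≗ {n} λ k → when-zero (j <ᶠ k)) (∑-zero n)) (∑-zero n)
  where
  when-zero : ∀ b → when b 0 ≡ 0
  when-zero true  = refl
  when-zero false = refl

-- The summands of gaps, clashes and gapsBefore copy the unfolded evalClause, so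
-- that the clause counts below match them by computation.
gaps : (Fin n → Bool) → ℕ
gaps {n} a = ∑[ j < n ] ∑[ k < n ]
  when (j <ᶠ k) ⟦ not (not (a j) ∨ (inside a j k ∨ (not (a k) ∨ false))) ⟧

-- Only the first one of `a` has no one before it. In `gaps-count` this counts the gaps that start
-- at a front entry equal to one.
first-count : ∀ {n} (a : Fin n → Bool) →
  ∑[ k < n ] ⟦ not (before a k ∨ (not (a k) ∨ false)) ⟧ ≡ ⟦ some a ⟧
first-count {zero}  a = refl
first-count {suc n} a rewrite some-false n with a zero
... | true  = cong suc (∑-zero n)
... | false = first-count (a ∘ suc)

-- Induction on the front entry. A zero there changes neither side. A one opens a new gap if the
-- tail has a one; otherwise it removes the correction for the zero vector. The `+ 1` avoids
-- truncated subtraction.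
gaps-count : ∀ {n} (a : Fin n → Bool) → gaps a + 1 ≡ ones a + ⟦ not (some a) ⟧
gaps-count {zero}  a = refl
gaps-count {suc n} a with a zero
... | false = begin
  ∑[ k < n ] 0 + gaps a′ + 1       ≡⟨ cong (λ (z : ℕ) → z + gaps a′ + 1) (∑-zero n) ⟩
  gaps a′ + 1                      ≡⟨ gaps-count a′ ⟩
  ones a′ + ⟦ not (some a′) ⟧      ∎
  where a′ = a ∘ suc
... | true = begin
  ∑[ k < n ] ⟦ not (before a′ k ∨ (not (a′ k) ∨ false)) ⟧ + gaps a′ + 1
    ≡⟨ cong (λ z → z + gaps a′ + 1) (first-count a′) ⟩
  ⟦ some a′ ⟧ + gaps a′ + 1
    ≡⟨ +-assoc ⟦ some a′ ⟧ _ _ ⟩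
  ⟦ some a′ ⟧ + (gaps a′ + 1)
    ≡⟨ cong (⟦ some a′ ⟧ +_) (gaps-count a′) ⟩
  ⟦ some a′ ⟧ + (ones a′ + ⟦ not (some a′) ⟧)
    ≡⟨ step (some a′) (ones a′) ⟩
  1 + ones a′ + 0                  ∎
  where
  a′ = a ∘ suc
  step : ∀ b x → ⟦ b ⟧ + (x + ⟦ not b ⟧) ≡ 1 + x + 0
  step true  x = refl
  step false x = trans (+-comm x 1) (sym (+-identityʳ (suc x)))

-- The number of ones after the first one, written as the part of `gapsBefore` that starts at a
-- prepended one.
afterFirst : (Fin n → Bool) → ℕ
afterFirst {n} a = ∑[ k < n ] ∑[ i < n ]
  when (k <ᶠ i) ⟦ not (before a k ∨ (not (a k) ∨ (not (a i) ∨ false))) ⟧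

ones-not-not : (a : Fin n → Bool) →
  ∑[ i < n ] ⟦ not (not (a i) ∨ false) ⟧ ≡ ones a
ones-not-not a = sum-cong-≗ λ i → step (a i)
  where
  step : ∀ b → ⟦ not (not b ∨ false) ⟧ ≡ ⟦ b ⟧
  step true  = refl
  step false = refl

afterFirst-count : ∀ {n} (a : Fin n → Bool) → afterFirst a + ⟦ some a ⟧ ≡ ones a
afterFirst-count {zero}  a = refl
afterFirst-count {suc n} a rewrite some-false n with a zero
... | true = begin
  -- The front entry is itself the first one: `k = zero` contributes every later one, and any other
  -- `k` has a one before it.
  ∑[ i < n ] ⟦ not (not (a′ i) ∨ false) ⟧ + ∑[ k < n ] ∑[ i < n ] when (k <ᶠ i) 0 + 1
    ≡⟨ cong₂ (λ x y → x + y + 1) (ones-not-not a′) (∑-when-zero n) ⟩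
  ones a′ + 0 + 1
    ≡⟨ trans (cong (_+ 1) (+-identityʳ _)) (+-comm _ 1) ⟩
  1 + ones a′  ∎
  where a′ = a ∘ suc
... | false = begin
  ∑[ i < n ] 0 + afterFirst a′ + ⟦ some a′ ⟧ ≡⟨ cong (λ z → z + afterFirst a′ + ⟦ some a′ ⟧) (∑-zero n) ⟩
  afterFirst a′ + ⟦ some a′ ⟧                ≡⟨ afterFirst-count a′ ⟩
  ones a′                                    ∎
  where a′ = a ∘ suc

-- The binomial coefficient C(c,2) for a vector with c ones.
clashes : (Fin n → Bool) → ℕ
clashes {n} a = ∑[ i < n ] ∑[ k < n ]
  when (i <ᶠ k) ⟦ not (not (a i) ∨ (not (a k) ∨ false)) ⟧

-- Gaps paired with a later one: (c - 1)(c - 2)/2 if there are c ≥ 1 ones. The condition on `i` and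
-- `k` stands outside the inner sum, as in `∑ₗ-triples`.
gapsBefore : (Fin n → Bool) → ℕ
gapsBefore {n} a = ∑[ i < n ] ∑[ k < n ] when (i <ᶠ k) (∑[ i′ < n ]
  when (k <ᶠ i′) ⟦ not (not (a i) ∨ (inside a i k ∨ (not (a k) ∨ (not (a i′) ∨ false)))) ⟧)

-- Prepending a one to `a′` adds `ones a′` to the clashes. On the left it adds `afterFirst a′`,
-- which by `afterFirst-count` falls short of `ones a′` by one if `a′` has a one; the new one in
-- `ones` makes up for this. If `a′` has no one, the new one replaces the lost term for the zero
-- vector.
gapsBefore-count : ∀ {n} (a : Fin n → Bool) →
  (⟦ not (some a) ⟧ + gapsBefore a) + ones a ≡ clashes a + 1
gapsBefore-count {zero}  a = refl
gapsBefore-count {suc n} a with a zero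
... | false = begin
  ⟦ not (some a′) ⟧ + (∑[ k < n ] ∑[ i < n ] when (k <ᶠ i) 0 + gapsBefore a′) + ones a′
    ≡⟨ cong (λ x → ⟦ not (some a′) ⟧ + (x + gapsBefore a′) + ones a′) (∑-when-zero n) ⟩
  ⟦ not (some a′) ⟧ + gapsBefore a′ + ones a′
    ≡⟨ gapsBefore-count a′ ⟩
  clashes a′ + 1
    ≡⟨ cong (λ x → x + clashes a′ + 1) (∑-zero n) ⟨
  ∑[ k < n ] 0 + clashes a′ + 1 ∎
  where a′ = a ∘ suc
... | true = begin
  (afterFirst a′ + gapsBefore a′) + (1 + ones a′)
    ≡⟨ step (some a′) (afterFirst-count a′) (gapsBefore-count a′) ⟩
  ones a′ + clashes a′ + 1
    ≡⟨ cong (λ x → x + clashes a′ + 1) (ones-not-not a′) ⟨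
  ∑[ k < n ] ⟦ not (not (a′ k) ∨ false) ⟧ + clashes a′ + 1 ∎
  where
  a′ = a ∘ suc
  step : ∀ {f g o c} b → f + ⟦ b ⟧ ≡ o → (⟦ not b ⟧ + g) + o ≡ c + 1 →
    (f + g) + (1 + o) ≡ o + c + 1
  step {f} {g} {o} {c} b refl q = begin
    (f + g) + (1 + (f + ⟦ b ⟧))                ≡⟨ lemma b ⟩
    (f + ⟦ b ⟧) + (⟦ not b ⟧ + g + (f + ⟦ b ⟧)) ≡⟨ cong (f + ⟦ b ⟧ +_) q ⟩
    (f + ⟦ b ⟧) + (c + 1)                      ≡⟨ +-assoc (f + ⟦ b ⟧) c 1 ⟨
    (f + ⟦ b ⟧) + c + 1                        ∎
    where
    -- The identity rests on `⟦ b ⟧ + ⟦ not b ⟧` being 1, which the ring solver sees only once `b`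
    -- is fixed.
    on : ∀ f g → (f + g) + (1 + (f + 1)) ≡ (f + 1) + (g + (f + 1))
    on = solve-∀
    off : ∀ f g → (f + g) + (1 + (f + 0)) ≡ (f + 0) + (1 + g + (f + 0))
    off = solve-∀
    lemma : ∀ b → (f + g) + (1 + (f + ⟦ b ⟧)) ≡ (f + ⟦ b ⟧) + (⟦ not b ⟧ + g + (f + ⟦ b ⟧))
    lemma true  = on f g
    lemma false = off f g

-- Distinctness of the clauses

infix 4 _≉_
_≉_ : Clause V → Clause V → Set
C ≉ D = ¬ C ≋ D

deduplicate-distinct : {R : X → X → Set} (R? : Decidable₂ R) {xs : List X} →
  AllPairs (λ x y → ¬ R x y) xs → deduplicate R? xs ≡ xs
deduplicate-distinct R? []         = refl
deduplicate-distinct R? (px ∷ pxs)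
  rewrite deduplicate-distinct R? pxs = cong (_ ∷_) (filter-all _ px)

viol-distinct : (_≟_ : DecidableEquality V) {F : Formula V} → AllPairs _≉_ F → ∀ A →
  viol _≟_ F A ≡ length (filter (λ C → evalClause A C Bool.≟ false) F)
viol-distinct _≟_ F! A =
  cong (length ∘ filter _) (deduplicate-distinct (clause-≋? _≟_) F!)

-- Both heads are the least element of the same set. Strictness keeps the head out of its own tail,
-- so the inclusions pass to the tails.
sorted-unique : {xs ys : List (Fin n)} → AllPairs _<_ xs → AllPairs _<_ ys →
  xs ⊆ ys → ys ⊆ xs → xs ≡ ys
sorted-unique []       []       _     _     = refl
sorted-unique []       (_ ∷ _)  _     ys⊆xs = contradiction (ys⊆xs (here refl)) λ ()
sorted-unique (_ ∷ _)  []       xs⊆ys _     = contradiction (xs⊆ys (here refl)) λ ()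
sorted-unique {xs = x ∷ xs} {y ∷ ys} (x< ∷ xs!) (y< ∷ ys!) xs⊆ys ys⊆xs
  with x≡y (xs⊆ys (here refl)) (ys⊆xs (here refl))
  where
  x≡y : x ∈ y ∷ ys → y ∈ x ∷ xs → x ≡ y
  x≡y (here eq)    _            = eq
  x≡y (there _)    (here eq)    = sym eq
  -- Here each head would be smaller than the other.
  x≡y (there x∈ys) (there y∈xs) =
    contradiction (All.lookup x< y∈xs) (Fin.<-asym (All.lookup y< x∈ys))
... | refl = cong (x ∷_) (sorted-unique xs! ys! (tail⊆ x< xs⊆ys) (tail⊆ y< ys⊆xs))
  where
  tail⊆ : ∀ {zs ws} → All (x <_) zs → x ∷ zs ⊆ x ∷ ws → zs ⊆ ws
  tail⊆ x<zs ⊆ws z∈zs with ⊆ws (there z∈zs)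
  ... | here refl  = contradiction (All.lookup x<zs z∈zs) (Fin.<-irrefl refl)
  ... | there z∈ws = z∈ws

var : Literal V → V
var (pos x) = x
var (neg x) = x

isPos : Literal V → Bool
isPos (pos _) = true
isPos (neg _) = false

negatedIn : (V → X) → Literal V → List X
negatedIn g (pos _) = []
negatedIn g (neg x) = [ g x ]

negated : (V → X) → Clause V → List X
negated g = concatMap (negatedIn g)

negated-pos-++ : (g : V → X) (h : Y → V) (ys : List Y) (C : Clause V) →
  negated g (map (λ y → pos (h y)) ys ++ C) ≡ negated g C
negated-pos-++ g h []       C = refl
negated-pos-++ g h (_ ∷ ys) C = negated-pos-++ g h ys C

-- Equal literal sets only give key lists with the same elements; order and repetition could still
-- differ. The sortedness guaranteed by `P` makes the lists equal, and the key determines the index.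
map-distinct : {P : X → Set} (f : X → Clause V) (g : V → Fin n) (key : X → List (Fin n)) →
  (∀ x → negated g (f x) ≡ key x) → (∀ {x} → P x → AllPairs _<_ (key x)) →
  (∀ {x y} → key x ≡ key y → x ≡ y) →
  ∀ {xs} → All P xs → Unique xs → AllPairs _≉_ (map f xs)
map-distinct {P = P} f g key f-key key-sorted key-inj = go
  where
  ≋⇒≡ : ∀ {x y} → P x → P y → f x ≋ f y → x ≡ y
  ≋⇒≡ {x} {y} px py (C⊆D , D⊆C) = key-inj (sorted-unique (key-sorted px) (key-sorted py)
    (subst₂ _⊆_ (f-key x) (f-key y) (concatMap⁺ (negatedIn g) C⊆D))
    (subst₂ _⊆_ (f-key y) (f-key x) (concatMap⁺ (negatedIn g) D⊆C)))
  go : ∀ {xs} → All P xs → Unique xs → AllPairs _≉_ (map f xs)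
  go []         []         = []
  go (px ∷ pxs) (x∉ ∷ xs!) =
    All.map⁺ (All.zipWith (λ (py , x≢y) C≋D → x≢y (≋⇒≡ px py C≋D)) (pxs , x∉)) ∷ go pxs xs!

-- Separates clauses of different families: `g` colours literals by pigeon, by hole or by sign.
⊆⇒≡ : {g : Literal V → X} {b c : X} {C D : Clause V} →
  Any (λ l → g l ≡ b) C → All (λ l → g l ≡ c) D → C ⊆ D → b ≡ c
⊆⇒≡ (here refl) all  C⊆D = All.lookup all (C⊆D (here refl))
⊆⇒≡ (there any) all  C⊆D = ⊆⇒≡ any all (C⊆D ∘ there)

-- The `Any` part excludes the empty clause, which would otherwise have every colour.
Coloured : (Literal V → X) → X → Clause V → Set
Coloured g b C = Any (λ l → g l ≡ b) C × All (λ l → g l ≡ b) C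

concatMap-distinct : {F : Fin n → Formula V} (g : Literal V → Fin n) →
  (∀ i → AllPairs _≉_ (F i)) → (∀ i → All (Coloured g i) (F i)) →
  AllPairs _≉_ (concatMap F (allFin n))
concatMap-distinct {F = F} g F! F-col = AllPairs.concat⁺
  (All.map⁺ (All.universal F! _))
  (AllPairs.map⁺ (AllPairs.map
    (λ {i} {j} i≢j → All.map (λ (any , _) → All.map (λ (_ , all) (C⊆D , _) → i≢j (⊆⇒≡ any all C⊆D))
      (F-col j)) (F-col i))
    (Unique.allFin⁺ _)))

pairs-< : ∀ n → All (λ (a , b) → a < b) (pairs n)
pairs-< n = All.all-filter (λ (a , b) → a Fin.<? b)
  (cartesianProduct (allFin n) (allFin n))

pairs! : ∀ n → Unique (pairs n)
pairs! n = Unique.filter⁺ (λ (a , b) → a Fin.<? b)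
  (Unique.cartesianProduct⁺ (Unique.allFin⁺ n) (Unique.allFin⁺ n))

triples-< : ∀ n → All (λ (a , b , c) → a < b × b < c) (triples n)
triples-< n = All.all-filter (λ (a , b , c) → (a Fin.<? b) ×-dec (b Fin.<? c))
  (cartesianProduct (allFin n) (cartesianProduct (allFin n) (allFin n)))

triples! : ∀ n → Unique (triples n)
triples! n = Unique.filter⁺ (λ (a , b , c) → (a Fin.<? b) ×-dec (b Fin.<? c))
  (Unique.cartesianProduct⁺ (Unique.allFin⁺ n)
    (Unique.cartesianProduct⁺ (Unique.allFin⁺ n) (Unique.allFin⁺ n)))

pair-sorted : {a b : Fin n} → a < b → AllPairs _<_ (a ∷ b ∷ [])
pair-sorted a<b = (a<b ∷ []) ∷ [] ∷ []

triple-sorted : {a b c : Fin n} → a < b × b < c → AllPairs _<_ (a ∷ b ∷ c ∷ [])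
triple-sorted (a<b , b<c) = (a<b ∷ Fin.<-trans a<b b<c ∷ []) ∷ (b<c ∷ []) ∷ [] ∷ []

concatMap-All : {P : Y → Set} {F : Fin n → List Y} →
  (∀ i → All P (F i)) → All P (concatMap F (allFin n))
concatMap-All PF = All.concat⁺ (All.map⁺ (All.universal PF (allFin _)))

separate : {P Q : Clause V → Set} {F G : Formula V} →
  (∀ {C D} → P C → Q D → C ≉ D) → All P F → All Q G → All (λ C → All (C ≉_) G) F
separate sep PF QG = All.map (λ p → All.map (sep p) QG) PF

-- The clauses of `PHPᵟ` and `PHP`

module _ (m : ℕ) where

  pigeon column : Literal (Var m) → _
  pigeon = proj₁ ∘ var
  column = proj₂ ∘ var

  holeAxioms-distinct : ∀ j → AllPairs _≉_ (holeAxioms m j)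
  holeAxioms-distinct j = map-distinct _ proj₁ (λ (i , k) → i ∷ k ∷ [])
    (λ _ → refl) pair-sorted (λ { refl → refl }) (pairs-< (suc m)) (pairs! (suc m))

  Pᵟ-distinct : ∀ i → AllPairs _≉_ (Pᵟ m i)
  Pᵟ-distinct i = map-distinct _ proj₂ (λ (j , k) → j ∷ k ∷ [])
    (λ (j , k) → cong (j ∷_) (negated-pos-++ proj₂ (i ,_) (between j k) _))
    pair-sorted (λ { refl → refl }) (pairs-< m) (pairs! m)

  H2ᵟ-distinct : ∀ j → AllPairs _≉_ (H2ᵟ m j)
  H2ᵟ-distinct j = map-distinct _ proj₁ (λ (i , k , i′) → i ∷ k ∷ i′ ∷ [])
    (λ (i , k , _) → cong (i ∷_) (negated-pos-++ proj₁ (_, j) (between i k) _))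
    triple-sorted (λ { refl → refl }) (triples-< (suc m)) (triples! (suc m))

  Hᵟ-distinct : ∀ j → AllPairs _≉_ (H1ᵟ m j ++ H2ᵟ m j)
  Hᵟ-distinct j = AllPairs.++⁺ ([] ∷ []) (H2ᵟ-distinct j)
    -- An H2 clause starts with a negative literal, so it is not contained in the purely positive H1
    -- clause.
    (All.map⁺ (All.universal (λ _ (_ , D⊆C) →
      contradiction (⊆⇒≡ {g = isPos} (here refl) (All.map⁺ (All.universal (λ _ → refl) _)) D⊆C) λ ()) _) ∷ [])

  Pᵟ-row : ∀ i → All (Coloured pigeon i) (Pᵟ m i)
  Pᵟ-row i = All.map⁺ (All.universal (λ _ → here refl ,
    refl ∷ All.++⁺ (All.map⁺ (All.universal (λ _ → refl) _)) (refl ∷ [])) _)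

  -- The two negated variables lie in different columns. This separates these clauses from those of
  -- H1 and H2, each of which stays in a single column.
  Pᵟ-columns : ∀ i → All (λ C → ¬ ∃ λ j → All (λ l → column l ≡ j) C) (Pᵟ m i)
  Pᵟ-columns i = All.map⁺ (All.map
    (λ { {j , k} j<k (_ , refl ∷ all) → Fin.<⇒≢ j<k
      (sym (All.head (All.++⁻ʳ (map (λ ℓ → pos (i , ℓ)) (between j k)) all))) })
    (pairs-< m))

  holeAxioms-negative : ∀ j → All (All (λ l → isPos l ≡ false)) (holeAxioms m j)
  holeAxioms-negative j = All.map⁺ (All.universal (λ _ → refl ∷ refl ∷ []) _)

  holeAxioms-column : ∀ j → All (Coloured column j) (holeAxioms m j)
  holeAxioms-column j = All.map⁺ (All.universal (λ _ → here refl , refl ∷ refl ∷ []) _)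

  Hᵟ-column : ∀ j → All (Coloured column j) (H1ᵟ m j ++ H2ᵟ m j)
  Hᵟ-column j = All.++⁺
    ((here refl , All.map⁺ (All.universal (λ _ → refl) _)) ∷ [])
    (All.map⁺ (All.universal (λ _ → here refl ,
      refl ∷ All.++⁺ (All.map⁺ (All.universal (λ _ → refl) _)) (refl ∷ refl ∷ [])) _))

  PHPᵟ-distinct : AllPairs _≉_ (PHPᵟ m)
  PHPᵟ-distinct = AllPairs.++⁺
    (concatMap-distinct pigeon Pᵟ-distinct Pᵟ-row)
    (concatMap-distinct column Hᵟ-distinct Hᵟ-column)
    (separate (λ ¬col (_ , col) (C⊆D , _) → ¬col (_ , All.anti-mono C⊆D col))
      (concatMap-All Pᵟ-columns) (concatMap-All {P = λ C → ∃ λ j → All (λ l → column l ≡ j) C}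
        λ j → All.map (λ (_ , all) → j , all) (Hᵟ-column j)))

pigeonAxiom-positive : ∀ m →
  All (Any (λ l → isPos l ≡ true)) (map (pigeonAxiom (suc m)) (allFin (suc (suc m))))
pigeonAxiom-positive m = All.map⁺ (All.universal (λ _ → here refl) _)

-- With at least one hole, a pigeon axiom has a first literal; this literal reveals the pigeon and,
-- being positive, separates the axiom from all hole axioms.
PHP-distinct : ∀ m → AllPairs _≉_ (PHP (suc m))
PHP-distinct m = AllPairs.++⁺
  (AllPairs.map⁺ (AllPairs.map (λ i≢i′ (C⊆D , _) →
    i≢i′ (⊆⇒≡ {g = pigeon (suc m)} (here refl) (All.map⁺ (All.universal (λ _ → refl) _)) C⊆D))
    (Unique.allFin⁺ _)))
  (concatMap-distinct (column (suc m)) (holeAxioms-distinct (suc m)) (holeAxioms-column (suc m)))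
  (separate (λ any all (C⊆D , _) → contradiction (⊆⇒≡ any all C⊆D) λ ())
    (pigeonAxiom-positive m) (concatMap-All (holeAxioms-negative (suc m))))

-- Violated clauses as sums over indices

∑ₗ : List X → (X → ℕ) → ℕ
∑ₗ xs f = sumˡ (map f xs)

∑ₗ-++ : ∀ xs ys (f : X → ℕ) → ∑ₗ (xs ++ ys) f ≡ ∑ₗ xs f + ∑ₗ ys f
∑ₗ-++ xs ys f = trans (cong sumˡ (map-++ f xs ys)) (sumˡ-++ (map f xs) (map f ys))

∑ₗ-map : ∀ (g : X → Y) xs (f : Y → ℕ) → ∑ₗ (map g xs) f ≡ ∑ₗ xs (f ∘ g)
∑ₗ-map g xs f = cong sumˡ (sym (map-∘ xs))

∑ₗ-concatMap : ∀ (F : X → List Y) xs (f : Y → ℕ) →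
  ∑ₗ (concatMap F xs) f ≡ ∑ₗ xs (λ x → ∑ₗ (F x) f)
∑ₗ-concatMap F []       f = refl
∑ₗ-concatMap F (x ∷ xs) f =
  trans (∑ₗ-++ (F x) (concatMap F xs) f) (cong (∑ₗ (F x) f +_) (∑ₗ-concatMap F xs f))

∑ₗ-filter : {P : X → Set} (P? : Decidable P) → ∀ xs (f : X → ℕ) →
  ∑ₗ (filter P? xs) f ≡ ∑ₗ xs (λ x → when (does (P? x)) (f x))
∑ₗ-filter P? []       f = refl
∑ₗ-filter P? (x ∷ xs) f with does (P? x)
... | true  = cong (f x +_) (∑ₗ-filter P? xs f)
... | false = ∑ₗ-filter P? xs f

∑ₗ-cartesianProduct : ∀ xs (ys : List Y) (f : X × Y → ℕ) →
  ∑ₗ (cartesianProduct xs ys) f ≡ ∑ₗ xs (λ x → ∑ₗ ys (λ y → f (x , y)))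
∑ₗ-cartesianProduct []       ys f = refl
∑ₗ-cartesianProduct (x ∷ xs) ys f = trans
  (∑ₗ-++ (map (x ,_) ys) (cartesianProduct xs ys) f)
  (cong₂ _+_ (∑ₗ-map (x ,_) ys f) (∑ₗ-cartesianProduct xs ys f))

∑ₗ-tabulate : (g : Fin n → X) (f : X → ℕ) → ∑ₗ (tabulate g) f ≡ ∑[ i < n ] f (g i)
∑ₗ-tabulate {zero}  g f = refl
∑ₗ-tabulate {suc n} g f = cong (f (g zero) +_) (∑ₗ-tabulate (g ∘ suc) f)

∑ₗ-allFin : ∀ n (f : Fin n → ℕ) → ∑ₗ (allFin n) f ≡ ∑[ i < n ] f i
∑ₗ-allFin n = ∑ₗ-tabulate id

∑ₗ-pairs : ∀ n (f : Fin n × Fin n → ℕ) →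
  ∑ₗ (pairs n) f ≡ ∑[ a < n ] ∑[ b < n ] when (a <ᶠ b) (f (a , b))
∑ₗ-pairs n f = begin
  ∑ₗ (pairs n) f
    ≡⟨ ∑ₗ-filter (λ (a , b) → a Fin.<? b) (cartesianProduct (allFin n) (allFin n)) f ⟩
  ∑ₗ (cartesianProduct (allFin n) (allFin n)) (λ (a , b) → when (a <ᶠ b) (f (a , b)))
    ≡⟨ ∑ₗ-cartesianProduct (allFin n) (allFin n) _ ⟩
  ∑ₗ (allFin n) (λ a → ∑ₗ (allFin n) (λ b → when (a <ᶠ b) (f (a , b))))
    ≡⟨ ∑ₗ-allFin n _ ⟩
  ∑[ a < n ] ∑ₗ (allFin n) (λ b → when (a <ᶠ b) (f (a , b)))
    ≡⟨ sum-cong-≗ {n} (λ a → ∑ₗ-allFin n _) ⟩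
  ∑[ a < n ] ∑[ b < n ] when (a <ᶠ b) (f (a , b)) ∎

when-∧ : ∀ b c x → when (b ∧ c) x ≡ when b (when c x)
when-∧ true  c x = refl
when-∧ false c x = refl

∑ₗ-triples : ∀ n (f : Fin n × Fin n × Fin n → ℕ) →
  ∑ₗ (triples n) f ≡
  ∑[ a < n ] ∑[ b < n ] when (a <ᶠ b) (∑[ c < n ] when (b <ᶠ c) (f (a , b , c)))
∑ₗ-triples n f = begin
  ∑ₗ (triples n) f
    ≡⟨ ∑ₗ-filter (λ (a , b , c) → (a Fin.<? b) ×-dec (b Fin.<? c))
         (cartesianProduct (allFin n) (cartesianProduct (allFin n) (allFin n))) f ⟩
  ∑ₗ (cartesianProduct (allFin n) (cartesianProduct (allFin n) (allFin n))) g
    ≡⟨ ∑ₗ-cartesianProduct (allFin n) _ g ⟩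
  ∑ₗ (allFin n) (λ a → ∑ₗ (cartesianProduct (allFin n) (allFin n)) (λ p → g (a , p)))
    ≡⟨ ∑ₗ-allFin n _ ⟩
  ∑[ a < n ] ∑ₗ (cartesianProduct (allFin n) (allFin n)) (λ p → g (a , p))
    ≡⟨ sum-cong-≗ {n} (λ a → trans
         (∑ₗ-cartesianProduct (allFin n) (allFin n) _) (∑ₗ-allFin n _)) ⟩
  ∑[ a < n ] ∑[ b < n ] ∑ₗ (allFin n) (λ c → g (a , b , c))
    ≡⟨ sum-cong-≗ {n} (λ a → sum-cong-≗ {n} λ b → inner a b) ⟩
  ∑[ a < n ] ∑[ b < n ] when (a <ᶠ b) (∑[ c < n ] when (b <ᶠ c) (f (a , b , c))) ∎
  where
  g : Fin n × Fin n × Fin n → ℕ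
  g (a , b , c) = when ((a <ᶠ b) ∧ (b <ᶠ c)) (f (a , b , c))
  inner : ∀ a b → ∑ₗ (allFin n) (λ c → g (a , b , c)) ≡
    when (a <ᶠ b) (∑[ c < n ] when (b <ᶠ c) (f (a , b , c)))
  inner a b = begin
    ∑ₗ (allFin n) (λ c → g (a , b , c))
      ≡⟨ ∑ₗ-allFin n _ ⟩
    ∑[ c < n ] g (a , b , c)
      -- The condition on `a` and `b` does not depend on `c`, so it can leave the sum.
      ≡⟨ sum-cong-≗ {n} (λ c → when-∧ (a <ᶠ b) (b <ᶠ c) _) ⟩
    ∑[ c < n ] when (a <ᶠ b) (when (b <ᶠ c) (f (a , b , c)))
      ≡⟨ ∑-when (a <ᶠ b) (λ c → when (b <ᶠ c) (f (a , b , c))) ⟩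
    when (a <ᶠ b) (∑[ c < n ] when (b <ᶠ c) (f (a , b , c))) ∎

any-filter : (p : X → Bool) {P : X → Set} (P? : Decidable P) → ∀ xs →
  any p (filter P? xs) ≡ any (λ x → does (P? x) ∧ p x) xs
any-filter p P? []       = refl
any-filter p P? (x ∷ xs) with does (P? x)
... | true  = cong (p x ∨_) (any-filter p P? xs)
... | false = any-filter p P? xs

module _ (A : Assignment V) where

  violated : Clause V → ℕ
  violated C = ⟦ not (evalClause A C) ⟧

  length-falsified : ∀ F →
    length (filter (λ C → evalClause A C Bool.≟ false) F) ≡ ∑ₗ F violated
  length-falsified []      = refl
  length-falsified (C ∷ F) with evalClause A C
  ... | true  = length-falsified F
  ... | false = cong suc (length-falsified F)

  evalClause-pos-++ : (h : X → V) (xs : List X) (D : Clause V) →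
    evalClause A (map (λ x → pos (h x)) xs ++ D) ≡ any (A ∘ h) xs ∨ evalClause A D
  evalClause-pos-++ h []       D = refl
  evalClause-pos-++ h (x ∷ xs) D = trans
    (cong (A (h x) ∨_) (evalClause-pos-++ h xs D)) (sym (Bool.∨-assoc (A (h x)) _ _))

  evalClause-pos : (h : Fin n → V) →
    evalClause A (map (λ x → pos (h x)) (allFin n)) ≡ some (A ∘ h)
  evalClause-pos h = cong or (trans (sym (map-∘ (allFin _))) (map-tabulate id (A ∘ h)))

  evalClause-between-++ : (h : Fin n → V) (j k : Fin n) (D : Clause V) →
    evalClause A (map (λ x → pos (h x)) (between j k) ++ D) ≡
    inside (A ∘ h) j k ∨ evalClause A D
  evalClause-between-++ h j k D = trans (evalClause-pos-++ h (between j k) D)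
    (cong (_∨ evalClause A D) (trans
      (any-filter (A ∘ h) (λ ℓ → (j Fin.<? ℓ) ×-dec (ℓ Fin.<? k)) (allFin _))
      (cong or (map-tabulate id (λ ℓ → ((j <ᶠ ℓ) ∧ (ℓ <ᶠ k)) ∧ A (h ℓ))))))

-- Double counting over rows and columns

module _ {m : ℕ} (A : Assignment (Var m)) where

  row : Fin (suc m) → Fin m → Bool
  row i j = A (i , j)

  col : Fin m → Fin (suc m) → Bool
  col j i = A (i , j)

  Pᵟ-violated : ∀ i → ∑ₗ (Pᵟ m i) (violated A) ≡ gaps (row i)
  Pᵟ-violated i = trans (∑ₗ-map _ (pairs m) (violated A)) (trans (∑ₗ-pairs m _)
    (sum-cong-≗ {m} λ j → sum-cong-≗ {m} λ k → cong (when (j <ᶠ k))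
      (cong (λ b → ⟦ not (not (A (i , j)) ∨ b) ⟧) (evalClause-between-++ A (i ,_) j k _))))

  pigeonAxiom-violated : ∀ i → violated A (pigeonAxiom m i) ≡ ⟦ not (some (row i)) ⟧
  pigeonAxiom-violated i = cong (λ b → ⟦ not b ⟧) (evalClause-pos A (i ,_))

  holeAxioms-violated : ∀ j → ∑ₗ (holeAxioms m j) (violated A) ≡ clashes (col j)
  holeAxioms-violated j =
    trans (∑ₗ-map _ (pairs (suc m)) (violated A)) (∑ₗ-pairs (suc m) _)

  Hᵟ-violated : ∀ j → ∑ₗ (H1ᵟ m j ++ H2ᵟ m j) (violated A) ≡
    ⟦ not (some (col j)) ⟧ + gapsBefore (col j)
  -- `H1ᵟ` is a singleton, so the list sum splits off its term by computation.
  Hᵟ-violated j = cong₂ _+_ (cong (λ b → ⟦ not b ⟧) (evalClause-pos A (_, j)))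
    (trans (∑ₗ-map _ (triples (suc m)) (violated A)) (trans (∑ₗ-triples (suc m) _)
      (sum-cong-≗ {suc m} λ i → sum-cong-≗ {suc m} λ k → cong (when (i <ᶠ k))
        (sum-cong-≗ {suc m} λ i′ → cong (when (k <ᶠ i′))
          (cong (λ b → ⟦ not (not (A (i , j)) ∨ b) ⟧) 
            (evalClause-between-++ A (_, j) i k (neg (k , j) ∷ neg (i′ , j) ∷ [])))))))

  emptyRows clashing ∑gaps ∑Hᵟ total : ℕ
  emptyRows = ∑[ i < suc m ] ⟦ not (some (row i)) ⟧
  clashing  = ∑[ j < m ] clashes (col j)
  ∑gaps     = ∑[ i < suc m ] gaps (row i)
  ∑Hᵟ       = ∑[ j < m ] (⟦ not (some (col j)) ⟧ + gapsBefore (col j))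
  total     = ∑[ i < suc m ] ones (row i)

  PHP-violated : ∑ₗ (PHP m) (violated A) ≡ emptyRows + clashing
  PHP-violated = trans (∑ₗ-++ (map (pigeonAxiom m) (allFin (suc m))) _ (violated A)) (cong₂ _+_
    (trans (∑ₗ-map _ (allFin (suc m)) (violated A))
      (trans (∑ₗ-allFin (suc m) _) (sum-cong-≗ pigeonAxiom-violated)))
    (trans (∑ₗ-concatMap _ (allFin m) (violated A))
      (trans (∑ₗ-allFin m _) (sum-cong-≗ holeAxioms-violated))))

  PHPᵟ-violated : ∑ₗ (PHPᵟ m) (violated A) ≡ ∑gaps + ∑Hᵟ
  PHPᵟ-violated = trans (∑ₗ-++ (concatMap (Pᵟ m) (allFin (suc m))) _ (violated A)) (cong₂ _+_
    (trans (∑ₗ-concatMap (Pᵟ m) (allFin (suc m)) (violated A))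
      (trans (∑ₗ-allFin (suc m) _) (sum-cong-≗ Pᵟ-violated)))
    (trans (∑ₗ-concatMap _ (allFin m) (violated A))
      (trans (∑ₗ-allFin m _) (sum-cong-≗ Hᵟ-violated))))

  rows : ∑gaps + suc m ≡ total + emptyRows
  rows = begin
    ∑gaps + suc m
      ≡⟨ cong (∑gaps +_) (∑-one (suc m)) ⟨
    ∑gaps + ∑[ i < suc m ] 1
      ≡⟨ ∑-distrib-+ (gaps ∘ row) (λ _ → 1) ⟨
    ∑[ i < suc m ] (gaps (row i) + 1)
      ≡⟨ sum-cong-≗ {suc m} (gaps-count ∘ row) ⟩
    ∑[ i < suc m ] (ones (row i) + ⟦ not (some (row i)) ⟧)
      ≡⟨ ∑-distrib-+ (ones ∘ row) (λ i → ⟦ not (some (row i)) ⟧) ⟩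
    total + emptyRows ∎

  columns : ∑Hᵟ + total ≡ clashing + m
  columns = begin
    ∑Hᵟ + total
      -- The ones of `A` are counted by columns instead of rows, to match the column identity.
      ≡⟨ cong (∑Hᵟ +_) (∑-comm λ i j → ⟦ A (i , j) ⟧) ⟩
    ∑Hᵟ + ∑[ j < m ] ones (col j)
      ≡⟨ ∑-distrib-+ {m} _ (ones ∘ col) ⟨
    ∑[ j < m ] (⟦ not (some (col j)) ⟧ + gapsBefore (col j) + ones (col j))
      ≡⟨ sum-cong-≗ {m} (gapsBefore-count ∘ col) ⟩
    ∑[ j < m ] (clashes (col j) + 1)
      ≡⟨ ∑-distrib-+ (clashes ∘ col) (λ _ → 1) ⟩
    clashing + ∑[ j < m ] 1
      ≡⟨ cong (clashing +_) (∑-one m) ⟩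
    clashing + m ∎

  violated-count : suc (∑ₗ (PHPᵟ m) (violated A)) ≡ ∑ₗ (PHP m) (violated A)
  violated-count rewrite PHP-violated | PHPᵟ-violated =
    -- Adding `rows` and `columns` puts `total` on both sides. The constants are `suc m` from the
    -- rows and `m` from the columns, and their difference is the outer `suc`.
    +-cancelʳ-≡ (m + total) _ _ (begin
      suc (∑gaps + ∑Hᵟ) + (m + total)       ≡⟨ left ∑gaps ∑Hᵟ m total ⟩
      (∑gaps + suc m) + (∑Hᵟ + total)       ≡⟨ cong₂ _+_ rows columns ⟩
      (total + emptyRows) + (clashing + m)  ≡⟨ right total emptyRows clashing m ⟩
      (emptyRows + clashing) + (m + total)  ∎)
    where
    left : ∀ g h m t → suc (g + h) + (m + t) ≡ (g + suc m) + (h + t)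
    left = solve-∀
    right : ∀ t e c m → (t + e) + (c + m) ≡ (e + c) + (m + t)
    right = solve-∀

open import Data.Integer.Base using (+_; _-_; 1ℤ)

theorem4p5 : (m : ℕ) → m ≥ 1 → (A : Assignment (Var m)) →
    + viol (var-≟ m) (PHPᵟ m) A ≡ + viol (var-≟ m) (PHP m) A - 1ℤ
theorem4p5 m@(suc m′) _ A
  rewrite viol-distinct (var-≟ m) (PHPᵟ-distinct m) A | length-falsified A (PHPᵟ m)
        | viol-distinct (var-≟ m) (PHP-distinct m′) A | length-falsified A (PHP m)
        -- Once the count for `PHP` has the form `suc x`, subtracting `1ℤ` computes to `+ x`.
        | sym (violated-count A) = refl
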